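{- Let $D=\mathbb{Z}[\omega]$ with $\omega=\frac{ -1+i\sqrt{3}}{2}$, and let $p$ and $q$ be rational primes. (1) If $q\equiv 2\pmod 3$, then $q$ is prime in $D$. (2) If $p\equiv 1\pmod 3$, then $p=N\pi=\pi\overline{\pi}$ for some prime $\pi$ of $D$. (3) $3=-\omega^{2}(1-\omega)^{2}$, and $1-\omega$ is prime in $D$.
   Context: A rational prime is a prime of $\mathbb{Z}$. For $\alpha=a+b\omega\in D$ with $a,b\in\mathbb{Z}$, the norm is $N\alpha=\alpha\overline{\alpha}=a^2-ab+b^2$. -}

module Defs where

open import Algebra.Bundles using (CommutativeRing; Semiring)
open import Algebra.Structures using (IsCommutativeRing)
open import Data.Integer as ℤ using (ℤ; +_; -[1+_])
open import Data.Integer.Tactic.RingSolver using (solve-∀)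
open import Data.Nat using (ℕ)
open import Data.Product using (_,_)
open import Level using (0ℓ)
open import Relation.Binary.PropositionalEquality
  using (_≡_; refl; trans; cong; cong₂; isEquivalence)
import Algebra.Definitions.RawSemiring as RawSemiringDefinitions

-- a ∔ b ω stands for the complex number a + bω, where ω = (-1 + i√3)/2.
-- As 1 and ω are linearly independent over ℤ, the pair (a , b) is
-- determined by this number, so propositional equality is the right one.
infix 5 _∔_ω

record D : Set where
  constructor _∔_ω
  field
    coeff₁ : ℤ
    coeffω : ℤ

ι : ℤ → D
ι a = a ∔ + 0 ω

ω : D
ω = + 0 ∔ + 1 ω

private
  infixl 6 _⊕_
  infixl 7 _⊗_

  _⊕_ : D → D → D
  (a ∔ b ω) ⊕ (c ∔ d ω) = a ℤ.+ c ∔ b ℤ.+ d ω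

  ⊖_ : D → D
  ⊖ (a ∔ b ω) = ℤ.- a ∔ ℤ.- b ω

  -- (a + bω)(c + dω) = ac + (ad + bc)ω + bdω², and ω² = -1 - ω.
  _⊗_ : D → D → D
  (a ∔ b ω) ⊗ (c ∔ d ω) =
    a ℤ.* c ℤ.- b ℤ.* d ∔ a ℤ.* d ℤ.+ b ℤ.* c ℤ.- b ℤ.* d ω

  ⊕-assoc : ∀ x y z → (x ⊕ y) ⊕ z ≡ x ⊕ (y ⊕ z)
  ⊕-assoc (a ∔ b ω) (c ∔ d ω) (e ∔ f ω) = cong₂ _∔_ω (l a c e) (l b d f)
    where
    l : ∀ a b c → (a ℤ.+ b) ℤ.+ c ≡ a ℤ.+ (b ℤ.+ c)
    l = solve-∀

  ⊕-comm : ∀ x y → x ⊕ y ≡ y ⊕ x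
  ⊕-comm (a ∔ b ω) (c ∔ d ω) = cong₂ _∔_ω (l a c) (l b d)
    where
    l : ∀ a b → a ℤ.+ b ≡ b ℤ.+ a
    l = solve-∀

  ⊕-identityˡ : ∀ x → ι (+ 0) ⊕ x ≡ x
  ⊕-identityˡ (a ∔ b ω) = cong₂ _∔_ω (l a) (l b)
    where
    l : ∀ a → + 0 ℤ.+ a ≡ a
    l = solve-∀

  ⊕-identityʳ : ∀ x → x ⊕ ι (+ 0) ≡ x
  ⊕-identityʳ (a ∔ b ω) = cong₂ _∔_ω (l a) (l b)
    where
    l : ∀ a → a ℤ.+ + 0 ≡ a
    l = solve-∀

  ⊖-inverseˡ : ∀ x → (⊖ x) ⊕ x ≡ ι (+ 0)
  ⊖-inverseˡ (a ∔ b ω) = cong₂ _∔_ω (l a) (l b)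
    where
    l : ∀ a → ℤ.- a ℤ.+ a ≡ + 0
    l = solve-∀

  ⊖-inverseʳ : ∀ x → x ⊕ (⊖ x) ≡ ι (+ 0)
  ⊖-inverseʳ (a ∔ b ω) = cong₂ _∔_ω (l a) (l b)
    where
    l : ∀ a → a ℤ.+ ℤ.- a ≡ + 0
    l = solve-∀

  ⊗-assoc : ∀ x y z → (x ⊗ y) ⊗ z ≡ x ⊗ (y ⊗ z)
  ⊗-assoc (a ∔ b ω) (c ∔ d ω) (e ∔ f ω) =
    cong₂ _∔_ω (l a b c d e f) (r a b c d e f)
    where
    l : ∀ a b c d e f →
        (a ℤ.* c ℤ.- b ℤ.* d) ℤ.* e ℤ.- (a ℤ.* d ℤ.+ b ℤ.* c ℤ.- b ℤ.* d) ℤ.* f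
      ≡ a ℤ.* (c ℤ.* e ℤ.- d ℤ.* f) ℤ.- b ℤ.* (c ℤ.* f ℤ.+ d ℤ.* e ℤ.- d ℤ.* f)
    l = solve-∀
    r : ∀ a b c d e f →
        (a ℤ.* c ℤ.- b ℤ.* d) ℤ.* f ℤ.+ (a ℤ.* d ℤ.+ b ℤ.* c ℤ.- b ℤ.* d) ℤ.* e
          ℤ.- (a ℤ.* d ℤ.+ b ℤ.* c ℤ.- b ℤ.* d) ℤ.* f
      ≡ a ℤ.* (c ℤ.* f ℤ.+ d ℤ.* e ℤ.- d ℤ.* f) ℤ.+ b ℤ.* (c ℤ.* e ℤ.- d ℤ.* f)
          ℤ.- b ℤ.* (c ℤ.* f ℤ.+ d ℤ.* e ℤ.- d ℤ.* f)
    r = solve-∀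

  ⊗-comm : ∀ x y → x ⊗ y ≡ y ⊗ x
  ⊗-comm (a ∔ b ω) (c ∔ d ω) = cong₂ _∔_ω (l a b c d) (r a b c d)
    where
    l : ∀ a b c d → a ℤ.* c ℤ.- b ℤ.* d ≡ c ℤ.* a ℤ.- d ℤ.* b
    l = solve-∀
    r : ∀ a b c d → a ℤ.* d ℤ.+ b ℤ.* c ℤ.- b ℤ.* d
                  ≡ c ℤ.* b ℤ.+ d ℤ.* a ℤ.- d ℤ.* b
    r = solve-∀

  ⊗-identityˡ : ∀ x → ι (+ 1) ⊗ x ≡ x
  ⊗-identityˡ (a ∔ b ω) = cong₂ _∔_ω (l a b) (r a b)
    where
    l : ∀ a b → + 1 ℤ.* a ℤ.- + 0 ℤ.* b ≡ a
    l = solve-∀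
    r : ∀ a b → + 1 ℤ.* b ℤ.+ + 0 ℤ.* a ℤ.- + 0 ℤ.* b ≡ b
    r = solve-∀

  ⊗-identityʳ : ∀ x → x ⊗ ι (+ 1) ≡ x
  ⊗-identityʳ x = trans (⊗-comm x (ι (+ 1))) (⊗-identityˡ x)

  ⊗-distribˡ-⊕ : ∀ x y z → x ⊗ (y ⊕ z) ≡ x ⊗ y ⊕ x ⊗ z
  ⊗-distribˡ-⊕ (a ∔ b ω) (c ∔ d ω) (e ∔ f ω) =
    cong₂ _∔_ω (l a b c d e f) (r a b c d e f)
    where
    l : ∀ a b c d e f →
        a ℤ.* (c ℤ.+ e) ℤ.- b ℤ.* (d ℤ.+ f)
      ≡ (a ℤ.* c ℤ.- b ℤ.* d) ℤ.+ (a ℤ.* e ℤ.- b ℤ.* f)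
    l = solve-∀
    r : ∀ a b c d e f →
        a ℤ.* (d ℤ.+ f) ℤ.+ b ℤ.* (c ℤ.+ e) ℤ.- b ℤ.* (d ℤ.+ f)
      ≡ (a ℤ.* d ℤ.+ b ℤ.* c ℤ.- b ℤ.* d) ℤ.+ (a ℤ.* f ℤ.+ b ℤ.* e ℤ.- b ℤ.* f)
    r = solve-∀

  ⊗-distribʳ-⊕ : ∀ x y z → (y ⊕ z) ⊗ x ≡ y ⊗ x ⊕ z ⊗ x
  ⊗-distribʳ-⊕ x y z = trans (⊗-comm (y ⊕ z) x)
    (trans (⊗-distribˡ-⊕ x y z) (cong₂ _⊕_ (⊗-comm x y) (⊗-comm x z)))

  isCommutativeRing :
    IsCommutativeRing _≡_ _⊕_ _⊗_ ⊖_ (ι (+ 0)) (ι (+ 1))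
  isCommutativeRing = record
    { isRing = record
      { +-isAbelianGroup = record
        { isGroup = record
          { isMonoid = record
            { isSemigroup = record
              { isMagma = record
                { isEquivalence = isEquivalence ; ∙-cong = cong₂ _⊕_ }
              ; assoc = ⊕-assoc
              }
            ; identity = ⊕-identityˡ , ⊕-identityʳ
            }
          ; inverse = ⊖-inverseˡ , ⊖-inverseʳ
          ; ⁻¹-cong = cong ⊖_
          }
        ; comm = ⊕-comm
        }
      ; *-cong = cong₂ _⊗_
      ; *-assoc = ⊗-assoc
      ; *-identity = ⊗-identityˡ , ⊗-identityʳ
      ; distrib = ⊗-distribˡ-⊕ , ⊗-distribʳ-⊕
      }
    ; *-comm = ⊗-comm
    }

D-commutativeRing : CommutativeRing 0ℓ 0ℓ
D-commutativeRing = record { isCommutativeRing = isCommutativeRing }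

open CommutativeRing D-commutativeRing public
  using (_+_; _*_; -_; _-_; 0#; 1#)

open RawSemiringDefinitions
  (Semiring.rawSemiring (CommutativeRing.semiring D-commutativeRing)) public
  using (_^_; _∣_; Prime)

-- Complex conjugation: the conjugate of ω is (-1 - i√3)/2 = -1 - ω.
conj : D → D
conj (a ∔ b ω) = a ℤ.- b ∔ ℤ.- b ω

N : D → ℤ
N (a ∔ b ω) = a ℤ.* a ℤ.- a ℤ.* b ℤ.+ b ℤ.* b

N≡*conj : ∀ α → ι (N α) ≡ α * conj α
N≡*conj (a ∔ b ω) = cong₂ _∔_ω (l a b) (r a b)
  where
  l : ∀ a b → a ℤ.* a ℤ.- a ℤ.* b ℤ.+ b ℤ.* b
            ≡ a ℤ.* (a ℤ.- b) ℤ.- b ℤ.* (ℤ.- b)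
  l = solve-∀
  r : ∀ a b → + 0 ≡ a ℤ.* (ℤ.- b) ℤ.+ b ℤ.* (a ℤ.- b) ℤ.- b ℤ.* (ℤ.- b)
  r = solve-∀

-- 2ω + 1 plays the role of i√3.
[2ω+1]²≡-3 : (ι (+ 2) * ω + 1#) ^ 2 ≡ ι -[1+ 2 ]
[2ω+1]²≡-3 = refl

∔-ω≡ι+ι*ω : ∀ a b → (a ∔ b ω) ≡ ι a + ι b * ω
∔-ω≡ι+ι*ω a b = cong₂ _∔_ω (l a b) (r a b)
  where
  l : ∀ a b → a ≡ a ℤ.+ (b ℤ.* + 0 ℤ.- + 0 ℤ.* + 1)
  l = solve-∀
  r : ∀ a b → b ≡ + 0 ℤ.+ (b ℤ.* + 1 ℤ.+ + 0 ℤ.* + 0 ℤ.- + 0 ℤ.* + 1)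
  r = solve-∀

module ℤ-Ring =
  RawSemiringDefinitions ℤ.+-*-rawSemiring

-- Rational primes are taken positive: -7 ≡ 2 (mod 3) is a prime element
-- of ℤ but not of D, and -2 ≡ 1 (mod 3) is not a norm.
RationalPrime : ℕ → Set
RationalPrime p = ℤ-Ring.Prime (+ p)

-- A Fermat-style descent shows that a rational prime p which divides N(a + bω),
-- but not both a and b, is itself a norm: reduce α modulo k, where N α = kp, to
-- γ, and replace α by α conj(γ) / k, of norm mp with m < k. If N π = p, then
-- D/π ≅ ℤ/p, so π is prime; if p is not a norm, then p ∣ N α forces p ∣ α, so p
-- is prime in D. Norms are squares modulo 3, which excludes q ≡ 2 (mod 3). For
-- p ≡ 1 (mod 3) the map a ↦ 1/(1 - a) has order 3 on the p - 2 residues other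
-- than 0 and 1; as 3 ∤ p - 2 it has a fixed point a, and then p ∣ a² - a + 1 =
-- N(a + ω).

module Submission where

open import Defs
open import Data.Integer using (+_)
open import Data.Nat using (ℕ; _%_)
open import Data.Product using (_×_; ∃-syntax)
open import Relation.Binary.PropositionalEquality using (_≡_)

open import Algebra.Definitions.RawMagma using (_,_)
import Algebra.Properties.CommutativeMonoid.Sum
import Data.Nat.Properties as ℕₚ
open import Data.Fin using (Fin; toℕ; fromℕ<)
open import Data.Fin.Permutation using (permutation)
open import Data.Fin.Properties using (toℕ-injective; toℕ<n; toℕ-fromℕ<; any?; _≟_)
open import Data.Integer as ℤ using (ℤ; -[1+_])
import Data.Integer.DivMod as ℤ
open import Data.Integer.Divisibility.Signed as ∣ᶻ using (divides)
  renaming (_∣_ to _∣ᶻ_)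
import Data.Integer.Properties as ℤₚ
open import Data.Integer.Tactic.RingSolver using (solve-∀)
open import Data.Nat as ℕ using (zero; suc; z≤n; s≤s; NonZero)
open import Data.Nat.Coprimality using (coprime-Bézout; prime⇒coprime)
import Data.Nat.Divisibility as ℕ∣
open import Data.Nat.DivMod using ([m+kn]%n≡m%n; m≡m%n+[m/n]*n)
open import Data.Nat.GCD using (module Bézout)
open import Data.Nat.Induction using (Acc; acc; <-wellFounded)
import Data.Nat.Primality as ℕ
import Data.Nat.Tactic.RingSolver as ℕ-Solver
open import Data.Product using (_,_; proj₁; proj₂; swap; map₂)
open import Data.Sum using (_⊎_; inj₁; inj₂; [_,_]′)
import Data.Sum as Sum
open import Function using (_∘_)
open import Relation.Binary.Definitions using (tri<; tri≈; tri>)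
open import Relation.Binary.PropositionalEquality
  using (_≢_; refl; sym; trans; cong; cong₂; subst; module ≡-Reasoning)
open import Relation.Nullary using (¬_; yes; no; Dec; contradiction)
open import Relation.Nullary.Decidable using (from-no; from-yes)

open ∣ᶻ using (∣m∣n⇒∣m+n; ∣m∣n⇒∣m-n; ∣n⇒∣m*n)

-- Counting orbits of a map of order three

module Σ = Algebra.Properties.CommutativeMonoid.Sum ℕₚ.+-0-commutativeMonoid

χ[_<_] : ℕ → ℕ → ℕ
χ[ m < n ] = [ m ℕ.<? n ]
  where
  [_] : Dec (m ℕ.< n) → ℕ
  [ yes _ ] = 1
  [ no _ ]  = 0

<⇒χ≡1 : ∀ {m n} → m ℕ.< n → χ[ m < n ] ≡ 1
<⇒χ≡1 {m} {n} m<n with m ℕ.<? n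
... | yes _  = refl
... | no m≮n = contradiction m<n m≮n

>⇒χ≡0 : ∀ {m n} → n ℕ.< m → χ[ m < n ] ≡ 0
>⇒χ≡0 {m} {n} n<m with m ℕ.<? n
... | yes m<n = contradiction m<n (ℕₚ.<-asym n<m)
... | no _    = refl

least : ℕ → ℕ → ℕ → ℕ
least x y z = χ[ x < y ] ℕ.* χ[ x < z ]

Σleast : ℕ → ℕ → ℕ → ℕ
Σleast x y z = least x y z ℕ.+ least y z x ℕ.+ least z x y

Σleast-rotate : ∀ x y z → Σleast y z x ≡ Σleast x y z
Σleast-rotate x y z = rotate (least y z x) (least z x y) (least x y z)
  where
  rotate : ∀ a b c → a ℕ.+ b ℕ.+ c ≡ c ℕ.+ a ℕ.+ b
  rotate = ℕ-Solver.solve-∀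

first-least : ∀ {x y z} → x ℕ.< y → x ℕ.< z → Σleast x y z ≡ 1
first-least {x} {y} {z} x<y x<z
  rewrite <⇒χ≡1 x<y | <⇒χ≡1 x<z | >⇒χ≡0 x<y | >⇒χ≡0 x<z
        | ℕₚ.*-zeroʳ χ[ y < z ] = refl

-- `Σleast` is invariant under rotation, which brings every possible ordering to the case where the
-- first argument is least. The two cyclic chains of inequalities contradict transitivity.
unique-least : ∀ {x y z} → x ≢ y → y ≢ z → z ≢ x → Σleast x y z ≡ 1
unique-least {x} {y} {z} x≢y y≢z z≢x
  with ℕₚ.<-cmp x y | ℕₚ.<-cmp y z | ℕₚ.<-cmp z x
... | tri≈ _ x≡y _ | _            | _            = contradiction x≡y x≢y
... | _            | tri≈ _ y≡z _ | _            = contradiction y≡z y≢z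
... | _            | _            | tri≈ _ z≡x _ = contradiction z≡x z≢x
... | tri< x<y _ _ | _            | tri> _ _ x<z = first-least x<y x<z
... | tri> _ _ y<x | tri< y<z _ _ | _            =
  trans (sym (Σleast-rotate x y z)) (first-least y<z y<x)
... | _            | tri> _ _ z<y | tri< z<x _ _ =
  trans (Σleast-rotate z x y) (first-least z<x z<y)
... | tri< x<y _ _ | tri< y<z _ _ | tri< z<x _ _ =
  contradiction (ℕₚ.<-trans x<y y<z) (ℕₚ.<-asym z<x)
... | tri> _ _ y<x | tri> _ _ z<y | tri> _ _ x<z =
  contradiction (ℕₚ.<-trans z<y y<x) (ℕₚ.<-asym x<z)

sum-1 : ∀ n → Σ.sum {n} (λ _ → 1) ≡ n
sum-1 zero    = refl
sum-1 (suc n) = cong suc (sum-1 n)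

-- Every orbit has exactly three points, exactly one of which is least in it.
order3-free⇒3∣ : ∀ {n} (f : Fin n → Fin n) → (∀ i → f (f (f i)) ≡ i) →
                 (∀ i → f i ≢ i) → 3 ℕ∣.∣ n
order3-free⇒3∣ {n} f f³≗id f-free = ℕ∣.divides (Σ.sum c) (begin
  n                                                 ≡⟨ sum-1 n ⟨
  Σ.sum {n} (λ _ → 1)                               ≡⟨ Σ.sum-cong-≗ c-orbit ⟨
  Σ.sum (λ i → c i ℕ.+ c (f i) ℕ.+ c (f (f i)))
    ≡⟨ Σ.∑-distrib-+ (λ i → c i ℕ.+ c (f i)) (c ∘ f ∘ f) ⟩
  Σ.sum (λ i → c i ℕ.+ c (f i)) ℕ.+ Σ.sum (c ∘ f ∘ f)
    ≡⟨ cong (ℕ._+ Σ.sum (c ∘ f ∘ f)) (Σ.∑-distrib-+ c (c ∘ f)) ⟩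
  Σ.sum c ℕ.+ Σ.sum (c ∘ f) ℕ.+ Σ.sum (c ∘ f ∘ f)
    ≡⟨ cong₂ (λ s t → Σ.sum c ℕ.+ s ℕ.+ t) (sym (sum-∘f c))
         (sym (trans (sum-∘f c) (sum-∘f (c ∘ f)))) ⟩
  Σ.sum c ℕ.+ Σ.sum c ℕ.+ Σ.sum c                   ≡⟨ triple (Σ.sum c) ⟩
  Σ.sum c ℕ.* 3                                     ∎)
  where
  open ≡-Reasoning

  c : Fin n → ℕ
  c i = least (toℕ i) (toℕ (f i)) (toℕ (f (f i)))

  -- `f` is a permutation with inverse `f ∘ f`, so reindexing along it preserves sums.
  sum-∘f : ∀ t → Σ.sum t ≡ Σ.sum (t ∘ f)
  sum-∘f t = Σ.sum-permute t (permutation f (f ∘ f) f³≗id f³≗id)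

  ≢ : ∀ i → toℕ i ≢ toℕ (f i)
  ≢ i eq = f-free i (sym (toℕ-injective eq))

  c-orbit : ∀ i → c i ℕ.+ c (f i) ℕ.+ c (f (f i)) ≡ 1
  -- Once `f (f (f i))` is rewritten to `i`, the three summands form `Σleast` on the orbit of `i`.
  c-orbit i rewrite f³≗id i =
    unique-least (≢ i) (≢ (f i)) 
      (λ eq → ≢ (f (f i)) (trans eq (cong toℕ (sym (f³≗id i)))))

  triple : ∀ s → s ℕ.+ s ℕ.+ s ≡ s ℕ.* 3
  triple = ℕ-Solver.solve-∀

-- Divisibility in ℤ and rational primes

∣∧<⇒≡0 : ∀ {k n} → + k ∣ᶻ + n → n ℕ.< k → n ≡ 0
∣∧<⇒≡0 {n = zero}  _   _   = refl
∣∧<⇒≡0 {n = suc _} k∣n n<k = contradiction (∣ᶻ.∣⇒∣ᵤ k∣n) (ℕ∣.>⇒∤ n<k)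

-- |i - j| is at most max(i, j) < k, and the only multiple of k that small is 0.
∣-⇒≡ : ∀ {k i j} → i ℕ.< k → j ℕ.< k → + k ∣ᶻ + i ℤ.- + j → i ≡ j
∣-⇒≡ {k} {i} {j} i<k j<k k∣i-j = ℤₚ.+-injective (ℤₚ.i-j≡0⇒i≡j (+ i) (+ j)
  (ℤₚ.∣i∣≡0⇒i≡0 (∣∧<⇒≡0 (∣ᶻ.∣-trans k∣i-j ∣ᶻ.m∣∣m∣) ∣i-j∣<k)))
  where
  ∣i-j∣<k : ℤ.∣ + i ℤ.- + j ∣ ℕ.< k
  ∣i-j∣<k rewrite ℤₚ.m-n≡m⊖n i j =
    ℕₚ.≤-<-trans (ℤₚ.∣m⊝n∣≤m⊔n i j) (ℕₚ.⊔-pres-<m i<k j<k)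

∣-lincomb : ∀ {k u v} x y → k ∣ᶻ u → k ∣ᶻ v → k ∣ᶻ x ℤ.* u ℤ.+ y ℤ.* v
∣-lincomb x y k∣u k∣v = ∣m∣n⇒∣m+n (∣n⇒∣m*n x k∣u) (∣n⇒∣m*n y k∣v)

euclid : ∀ {p} → RationalPrime p → ∀ x y → + p ∣ᶻ x ℤ.* y → + p ∣ᶻ x ⊎ + p ∣ᶻ y
euclid p-prime x y (divides q eq) =
  Sum.map signed signed (ℤ-Ring.Prime.split-∣ p-prime {x} {y} (q , sym eq))
  where
  signed : ∀ {k n} → k ℤ-Ring.∣ n → k ∣ᶻ n
  signed (q , eq) = divides q (sym eq)

rationalPrime-∤1 : ∀ {p} → RationalPrime p → ¬ + p ∣ᶻ + 1
rationalPrime-∤1 p-prime (divides q eq) = ℤ-Ring.Prime.p∤1 p-prime (q , sym eq)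

-- Irreducibility is the bridge: if p = ed, then p divides e or d, and antisymmetry of divisibility
-- gives p = e, whence d = 1, or p = d.
rationalPrime⇒prime : ∀ {p} → RationalPrime p → ℕ.Prime p
rationalPrime⇒prime {zero}        p-prime = contradiction refl (ℤ-Ring.Prime.p≉0 p-prime)
rationalPrime⇒prime {suc zero}    p-prime = contradiction ∣ᶻ.∣-refl (rationalPrime-∤1 p-prime)
rationalPrime⇒prime {p@(suc (suc _))} p-prime = ℕ.irreducible⇒prime irreducible
  where
  irreducible : ℕ.Irreducible p
  irreducible {d} d∣p@(ℕ∣.divides e p≡e*d)
    with euclid p-prime (+ e) (+ d) (∣ᶻ.∣-reflexive (trans (cong +_ p≡e*d) (ℤₚ.pos-* e d)))
  ... | inj₂ p∣d = inj₂ (ℕ∣.∣-antisym d∣p (∣ᶻ.∣⇒∣ᵤ p∣d))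
  ... | inj₁ p∣e = inj₁ (ℕₚ.*-cancelˡ-≡ d 1 p (begin
    p ℕ.* d  ≡⟨ cong (ℕ._* d) p≡e ⟩
    e ℕ.* d  ≡⟨ p≡e*d ⟨
    p        ≡⟨ ℕₚ.*-identityʳ p ⟨
    p ℕ.* 1  ∎))
    where
    open ≡-Reasoning
    p≡e : p ≡ e
    p≡e = ℕ∣.∣-antisym (∣ᶻ.∣⇒∣ᵤ p∣e) (ℕ∣.divides d (trans p≡e*d (ℕₚ.*-comm e d)))

-- Residues modulo p and a root of a² - a + 1

negative-inverse : ∀ {p n} .{{_ : NonZero p}} .{{_ : NonZero n}} → ℕ.Prime p → n ℕ.< p →
                   ∃[ r ] (r ℕ.< p × + p ∣ᶻ + r ℤ.* + n ℤ.+ + 1)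
negative-inverse {p} {n} p-prime n<p = reduce (bézout (coprime-Bézout (prime⇒coprime p-prime n<p)))
  where
  l : ∀ r e p n → r ℤ.* n ℤ.+ + 1
                ≡ ((r ℤ.+ e ℤ.* p) ℤ.* n ℤ.+ + 1) ℤ.- (e ℤ.* n) ℤ.* p
  l = solve-∀

  l₂ : ∀ y n → (ℤ.- y) ℤ.* n ℤ.+ + 1 ≡ + 1 ℤ.- y ℤ.* n
  l₂ = solve-∀

  l₃ : ∀ x p → + 1 ℤ.- (+ 1 ℤ.+ x ℤ.* p) ≡ (ℤ.- x) ℤ.* p
  l₃ = solve-∀

  pos : ∀ {x y m k} → 1 ℕ.+ y ℕ.* m ≡ x ℕ.* k → + 1 ℤ.+ + y ℤ.* + m ≡ + x ℤ.* + k
  pos {x} {y} {m} {k} eq = trans (cong (ℤ._+_ (+ 1)) (sym (ℤₚ.pos-* y m)))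
    (trans (cong +_ eq) (ℤₚ.pos-* x k))

  -- The identity comes in two shapes: 1 + yn = xp yields u = y, and 1 + xp = yn yields u = -y.
  bézout : Bézout.Identity 1 p n → ∃[ u ] (+ p ∣ᶻ u ℤ.* + n ℤ.+ + 1)
  bézout (Bézout.+- x y eq) =
    + y , divides (+ x) (trans (ℤₚ.+-comm (+ y ℤ.* + n) (+ 1)) (pos {x} {y} eq))
  bézout (Bézout.-+ x y eq) =
    ℤ.- + y , divides (ℤ.- + x) (trans (l₂ (+ y) (+ n))
      (trans (cong (ℤ._-_ (+ 1)) (sym (pos {y} {x} eq))) (l₃ (+ x) (+ p))))

  reduce : ∃[ u ] (+ p ∣ᶻ u ℤ.* + n ℤ.+ + 1) → ∃[ r ] (r ℕ.< p × + p ∣ᶻ + r ℤ.* + n ℤ.+ + 1)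
  reduce (u , p∣un+1) = u ℤ.%ℕ p , ℤ.n%ℕd<d u p ,
    subst (+ p ∣ᶻ_) (sym (l (+ (u ℤ.%ℕ p)) (u ℤ./ℕ p) (+ p) (+ n)))
      (∣m∣n⇒∣m-n
        (subst (λ z → + p ∣ᶻ z ℤ.* + n ℤ.+ + 1) (ℤ.a≡a%ℕn+[a/ℕn]*n u p) p∣un+1)
        (∣n⇒∣m*n (u ℤ./ℕ p ℤ.* + n) ∣ᶻ.∣-refl))

-- On ℤ/p without 0 and 1, the relation b(a - 1) + 1 ≡ 0 is the graph of
-- a ↦ 1/(1 - a), which has order 3 and whose fixed points are the roots of
-- a² - a + 1. Here i : Fin m stands for the residue a = 2 + i.
module _ {m} (p-prime : ℕ.Prime (2 ℕ.+ m)) where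

  private
    p = 2 ℕ.+ m

    residue : Fin m → ℤ
    residue i = + (2 ℕ.+ toℕ i)

    _↝_ : ℤ → ℤ → Set
    a ↝ b = + p ∣ᶻ b ℤ.* (a ℤ.- + 1) ℤ.+ + 1

  -- Unfolding the Bézout computation makes conversion checking diverge in practice.
  abstract
    successor : ∀ i → ∃[ j ] (residue i ↝ residue j)
    successor i = index (negative-inverse p-prime (s≤s (ℕₚ.m<n⇒m<1+n (toℕ<n i))))
      where
      n : ℕ
      n = suc (toℕ i)

      l : ∀ n → + 1 ℤ.* n ℤ.+ + 1 ≡ + 1 ℤ.+ n
      l = solve-∀

      index : ∃[ r ] (r ℕ.< p × + p ∣ᶻ + r ℤ.* + n ℤ.+ + 1) → ∃[ j ] (residue i ↝ residue j)
      -- Here n is `residue i` minus 1. The value 0 would make p divide 1, and the value 1 would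
      -- make p divide n + 1, which lies strictly between 0 and p. The other values are those
      -- indexed by `Fin m`.
      index (zero , _ , p∣1) = contradiction (∣∧<⇒≡0 {n = 1} p∣1 (s≤s (s≤s z≤n))) λ ()
      index (suc zero , _ , p∣n+1) = contradiction
        (∣∧<⇒≡0 {n = suc n} (subst (+ p ∣ᶻ_) (l (+ n)) p∣n+1) (s≤s (s≤s (toℕ<n i)))) λ ()
      index (suc (suc r) , s≤s (s≤s r<m) , p∣rn+1) = fromℕ< r<m ,
        subst (λ k → + p ∣ᶻ + (2 ℕ.+ k) ℤ.* + n ℤ.+ + 1) (sym (toℕ-fromℕ< r<m)) p∣rn+1

  -- The first two steps combine to `c ↝ a`. Then a and d are both negative inverses of c - 1 modulo
  -- p, hence congruent.
  ↝³⇒≡ : ∀ {a b c d} → a ↝ b → b ↝ c → c ↝ d → + p ∣ᶻ d ℤ.- a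
  ↝³⇒≡ {a} {b} {c} {d} a↝b b↝c c↝d =
    subst (+ p ∣ᶻ_) (sym (l₂ a c d)) (∣-lincomb d (ℤ.- a)
      (subst (+ p ∣ᶻ_) (sym (l₁ a b c)) (∣-lincomb c (+ 1 ℤ.- a) a↝b b↝c)) c↝d)
    where
    l₁ : ∀ a b c → a ℤ.* (c ℤ.- + 1) ℤ.+ + 1
       ≡ c ℤ.* (b ℤ.* (a ℤ.- + 1) ℤ.+ + 1)
         ℤ.+ (+ 1 ℤ.- a) ℤ.* (c ℤ.* (b ℤ.- + 1) ℤ.+ + 1)
    l₁ = solve-∀
    l₂ : ∀ a c d → d ℤ.- a
       ≡ d ℤ.* (a ℤ.* (c ℤ.- + 1) ℤ.+ + 1)
         ℤ.+ (ℤ.- a) ℤ.* (d ℤ.* (c ℤ.- + 1) ℤ.+ + 1)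
    l₂ = solve-∀

  private
    next : Fin m → Fin m
    next i = proj₁ (successor i)

    ↝next : ∀ i → residue i ↝ residue (next i)
    ↝next i = proj₂ (successor i)

  next³≗id : ∀ i → next (next (next i)) ≡ i
  next³≗id i = toℕ-injective (ℕₚ.+-cancelˡ-≡ 2 (toℕ k) (toℕ i)
    (∣-⇒≡ {p} {2 ℕ.+ toℕ k} {2 ℕ.+ toℕ i} (s≤s (s≤s (toℕ<n k))) (s≤s (s≤s (toℕ<n i)))
      (↝³⇒≡ {residue i} {residue (next i)} {residue (next (next i))} {residue k}
        (↝next i) (↝next (next i)) (↝next (next (next i))))))
    where
    k = next (next (next i))

  p≡1[mod3]⇒∣N[a+ω] : p % 3 ≡ 1 → ∃[ a ] (+ p ∣ᶻ N (a ∔ + 1 ω))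
  p≡1[mod3]⇒∣N[a+ω] p%3≡1 = from (any? (λ i → next i ≟ i))
    where
    l : ∀ a → a ℤ.* (a ℤ.- + 1) ℤ.+ + 1 ≡ a ℤ.* a ℤ.- a ℤ.* + 1 ℤ.+ + 1 ℤ.* + 1
    l = solve-∀

    3∤m : ¬ 3 ℕ∣.∣ m
    3∤m (ℕ∣.divides c m≡3c) = contradiction (begin
      1                    ≡⟨ p%3≡1 ⟨
      (2 ℕ.+ m) % 3        ≡⟨ cong (λ k → (2 ℕ.+ k) % 3) m≡3c ⟩
      (2 ℕ.+ c ℕ.* 3) % 3  ≡⟨ [m+kn]%n≡m%n 2 c 3 ⟩
      2                    ∎) λ ()
      where open ≡-Reasoning

    from : Dec (∃[ i ] next i ≡ i) → ∃[ a ] (+ p ∣ᶻ N (a ∔ + 1 ω))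
    from (yes (i , next-i≡i)) = residue i , subst (+ p ∣ᶻ_) (l (residue i))
      (subst (λ j → residue i ↝ residue j) next-i≡i (↝next i))
    from (no next-free) = contradiction
      (order3-free⇒3∣ next next³≗id (λ i next-i≡i → next-free (i , next-i≡i))) 3∤m

-- Reduction modulo k and the descent on norms

N-swap : ∀ a b → N (a ∔ b ω) ≡ N (b ∔ a ω)
N-swap = l
  where
  l : ∀ a b → a ℤ.* a ℤ.- a ℤ.* b ℤ.+ b ℤ.* b ≡ b ℤ.* b ℤ.- b ℤ.* a ℤ.+ a ℤ.* a
  l = solve-∀

-- For 0 ≤ r, s the form r² - rs + s² is at most max(r, s)².
N-remainder : ∀ {k r s} → r ℕ.< k → s ℕ.< k →
  ∃[ n ] (N (+ r ∔ + s ω) ≡ + n × n ℕ.< k ℕ.* k × (n ≡ 0 → r ≡ 0 × s ≡ 0))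
N-remainder {k} {r} {s} r<k s<k =
  [ (λ r≤s → ordered r≤s s<k)
  , (λ s≤r → map₂ (λ (N≡n , n<k² , vanishes) →
      trans (N-swap (+ r) (+ s)) N≡n , n<k² , swap ∘ vanishes) (ordered s≤r r<k))
  ]′ (ℕₚ.≤-total r s)
  where
  ordered : ∀ {r s} → r ℕ.≤ s → s ℕ.< k →
    ∃[ n ] (N (+ r ∔ + s ω) ≡ + n × n ℕ.< k ℕ.* k × (n ≡ 0 → r ≡ 0 × s ≡ 0))
  ordered {r} r≤s s<k with ℕₚ.m≤n⇒∃[o]m+o≡n r≤s
  -- With s = r + d the form becomes r² + rd + d², which is free of subtraction and falls short of
  -- s² by rd.
  ... | d , refl = n , trans (l (+ r) (+ d)) n≡ , n<k² , vanishes
    where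
    n = r ℕ.* r ℕ.+ r ℕ.* d ℕ.+ d ℕ.* d

    l : ∀ r d → r ℤ.* r ℤ.- r ℤ.* (r ℤ.+ d) ℤ.+ (r ℤ.+ d) ℤ.* (r ℤ.+ d)
              ≡ r ℤ.* r ℤ.+ r ℤ.* d ℤ.+ d ℤ.* d
    l = solve-∀

    n≡ : + r ℤ.* + r ℤ.+ + r ℤ.* + d ℤ.+ + d ℤ.* + d ≡ + n
    n≡ = sym (cong₂ ℤ._+_ (cong₂ ℤ._+_ (ℤₚ.pos-* r r) (ℤₚ.pos-* r d)) (ℤₚ.pos-* d d))

    square : ∀ r d → (r ℕ.+ d) ℕ.* (r ℕ.+ d)
                   ≡ (r ℕ.* r ℕ.+ r ℕ.* d ℕ.+ d ℕ.* d) ℕ.+ r ℕ.* d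
    square = ℕ-Solver.solve-∀

    n<k² : n ℕ.< k ℕ.* k
    n<k² = ℕₚ.≤-<-trans (subst (n ℕ.≤_) (sym (square r d)) (ℕₚ.m≤m+n n (r ℕ.* d)))
      (ℕₚ.*-mono-< s<k s<k)

    root : ∀ m → m ℕ.* m ≡ 0 → m ≡ 0
    root m m²≡0 = Sum.reduce (ℕₚ.m*n≡0⇒m≡0∨n≡0 m m²≡0)

    vanishes : n ≡ 0 → r ≡ 0 × r ℕ.+ d ≡ 0
    vanishes n≡0 = r≡0 , cong₂ ℕ._+_ r≡0 (root d (ℕₚ.m+n≡0⇒n≡0 (r ℕ.* r ℕ.+ r ℕ.* d) n≡0))
      where
      r≡0 : r ≡ 0
      r≡0 = root r (ℕₚ.m+n≡0⇒m≡0 (r ℕ.* r) (ℕₚ.m+n≡0⇒m≡0 (r ℕ.* r ℕ.+ r ℕ.* d) n≡0))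

-- In terms of α = a + bω, γ = r + sω and δ = e + fω this is α = γ + kδ with N γ = mk; the bounds on
-- m make it the next multiplier of the descent.
record Reduction (k : ℕ) (a b : ℤ) : Set where
  field
    r s e f : ℤ
    a≡r+ek  : a ≡ r ℤ.+ e ℤ.* + k
    b≡s+fk  : b ≡ s ℤ.+ f ℤ.* + k
    m       : ℕ
    m≢0     : m ≢ 0
    m<k     : m ℕ.< k
    N≡mk    : N (r ∔ s ω) ≡ + m ℤ.* + k

-- The polar form of N, that is, the trace γ conj(δ) + δ conj(γ) for γ = r + sω and δ = e + fω.
polar : ℤ → ℤ → ℤ → ℤ → ℤ
polar r s e f = + 2 ℤ.* (r ℤ.* e) ℤ.- r ℤ.* f ℤ.- s ℤ.* e ℤ.+ + 2 ℤ.* (s ℤ.* f)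

N-expand : ∀ r s e f k → N (r ℤ.+ e ℤ.* k ∔ s ℤ.+ f ℤ.* k ω)
         ≡ N (r ∔ s ω) ℤ.+ (polar r s e f ℤ.+ N (e ∔ f ω) ℤ.* k) ℤ.* k
N-expand = l
  where
  l : ∀ r s e f k →
      (r ℤ.+ e ℤ.* k) ℤ.* (r ℤ.+ e ℤ.* k) ℤ.- (r ℤ.+ e ℤ.* k) ℤ.* (s ℤ.+ f ℤ.* k)
        ℤ.+ (s ℤ.+ f ℤ.* k) ℤ.* (s ℤ.+ f ℤ.* k)
    ≡ (r ℤ.* r ℤ.- r ℤ.* s ℤ.+ s ℤ.* s)
        ℤ.+ ((+ 2 ℤ.* (r ℤ.* e) ℤ.- r ℤ.* f ℤ.- s ℤ.* e ℤ.+ + 2 ℤ.* (s ℤ.* f))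
             ℤ.+ (e ℤ.* e ℤ.- e ℤ.* f ℤ.+ f ℤ.* f) ℤ.* k) ℤ.* k
  l = solve-∀

-- As α ≡ γ modulo k, also k ∣ N γ, and N γ < k² bounds the quotient m by k. If m = 0, then γ = 0
-- and k divides α.
reduce : ∀ k .{{_ : NonZero k}} a b → + k ∣ᶻ N (a ∔ b ω) →
         (+ k ∣ᶻ a × + k ∣ᶻ b) ⊎ Reduction k a b
reduce k a b k∣N = from-remainders
  {r = a ℤ.%ℕ k} {b ℤ.%ℕ k} {a ℤ./ℕ k} {b ℤ./ℕ k}
  (ℤ.n%ℕd<d a k) (ℤ.n%ℕd<d b k) (ℤ.a≡a%ℕn+[a/ℕn]*n a k) (ℤ.a≡a%ℕn+[a/ℕn]*n b k)
  where
  multiple : ∀ {x r} → r ≡ 0 → ∀ e → x ≡ + r ℤ.+ e ℤ.* + k → + k ∣ᶻ x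
  multiple refl e x≡ = divides e (trans x≡ (ℤₚ.+-identityˡ (e ℤ.* + k)))

  from-remainders : ∀ {r s e f} → r ℕ.< k → s ℕ.< k →
    a ≡ + r ℤ.+ e ℤ.* + k → b ≡ + s ℤ.+ f ℤ.* + k →
    (+ k ∣ᶻ a × + k ∣ᶻ b) ⊎ Reduction k a b
  from-remainders {r} {s} {e} {f} r<k s<k a≡ b≡ = from-norm (N-remainder r<k s<k)
    where
    γ+kδ-norm : N (a ∔ b ω)
              ≡ N (+ r ∔ + s ω) ℤ.+ (polar (+ r) (+ s) e f ℤ.+ N (e ∔ f ω) ℤ.* + k) ℤ.* + k
    γ+kδ-norm rewrite a≡ | b≡ = N-expand (+ r) (+ s) e f (+ k)

    k∣Nrs : + k ∣ᶻ N (+ r ∔ + s ω)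
    k∣Nrs = ∣ᶻ.∣m+n∣n⇒∣m {m = N (+ r ∔ + s ω)} (subst (+ k ∣ᶻ_) γ+kδ-norm k∣N)
      (divides (polar (+ r) (+ s) e f ℤ.+ N (e ∔ f ω) ℤ.* + k) refl)

    from-norm :
      ∃[ n ] (N (+ r ∔ + s ω) ≡ + n × n ℕ.< k ℕ.* k × (n ≡ 0 → r ≡ 0 × s ≡ 0)) →
      (+ k ∣ᶻ a × + k ∣ᶻ b) ⊎ Reduction k a b
    from-norm (n , N≡n , n<k² , vanishes) with ∣ᶻ.∣⇒∣ᵤ (subst (+ k ∣ᶻ_) N≡n k∣Nrs)
    ... | ℕ∣.divides zero n≡0 =
      inj₁ (multiple (proj₁ (vanishes n≡0)) e a≡ , multiple (proj₂ (vanishes n≡0)) f b≡)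
    ... | ℕ∣.divides m@(suc _) n≡mk = inj₂ record
      { r      = + r
      ; s      = + s
      ; e      = e
      ; f      = f
      ; a≡r+ek = a≡
      ; b≡s+fk = b≡
      ; m      = m
      ; m≢0    = λ ()
      ; m<k    = ℕₚ.*-cancelʳ-< k m k (subst (ℕ._< k ℕ.* k) n≡mk n<k²)
      ; N≡mk   = trans N≡n (trans (cong +_ n≡mk) (ℤₚ.pos-* m k))
      }

-- With α = γ + kδ, N α = kp and N γ = mk, the quotient
-- α conj(γ) / k = m + δ conj(γ) has norm mp.
descent-step : ∀ k p a b .{{_ : NonZero k}} → N (a ∔ b ω) ≡ + k ℤ.* p →
               (ρ : Reduction k a b) → ∃[ β ] N β ≡ + Reduction.m ρ ℤ.* p
descent-step k p a b N≡kp ρ =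
  (+ m ℤ.+ (e ℤ.* (r ℤ.- s) ℤ.+ f ℤ.* s) ∔ f ℤ.* r ℤ.- e ℤ.* s ω) , (begin
    N (+ m ℤ.+ (e ℤ.* (r ℤ.- s) ℤ.+ f ℤ.* s) ∔ f ℤ.* r ℤ.- e ℤ.* s ω)
      ≡⟨ l (+ m) r s e f ⟩
    + m ℤ.* (+ m ℤ.+ polar r s e f) ℤ.+ N (e ∔ f ω) ℤ.* N (r ∔ s ω)
      ≡⟨ cong (λ n → + m ℤ.* (+ m ℤ.+ polar r s e f) ℤ.+ N (e ∔ f ω) ℤ.* n) N≡mk ⟩
    + m ℤ.* (+ m ℤ.+ polar r s e f) ℤ.+ N (e ∔ f ω) ℤ.* (+ m ℤ.* + k)
      ≡⟨ l₂ (+ m) (polar r s e f) (N (e ∔ f ω)) (+ k) ⟩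
    + m ℤ.* (+ m ℤ.+ (polar r s e f ℤ.+ N (e ∔ f ω) ℤ.* + k))
      ≡⟨ cong (ℤ._*_ (+ m)) p≡ ⟨
    + m ℤ.* p ∎)
  where
  open Reduction ρ
  open ≡-Reasoning

  l : ∀ m r s e f →
      (m ℤ.+ (e ℤ.* (r ℤ.- s) ℤ.+ f ℤ.* s)) ℤ.* (m ℤ.+ (e ℤ.* (r ℤ.- s) ℤ.+ f ℤ.* s))
        ℤ.- (m ℤ.+ (e ℤ.* (r ℤ.- s) ℤ.+ f ℤ.* s)) ℤ.* (f ℤ.* r ℤ.- e ℤ.* s)
        ℤ.+ (f ℤ.* r ℤ.- e ℤ.* s) ℤ.* (f ℤ.* r ℤ.- e ℤ.* s)
    ≡ m ℤ.* (m ℤ.+ (+ 2 ℤ.* (r ℤ.* e) ℤ.- r ℤ.* f ℤ.- s ℤ.* e ℤ.+ + 2 ℤ.* (s ℤ.* f)))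
        ℤ.+ (e ℤ.* e ℤ.- e ℤ.* f ℤ.+ f ℤ.* f) ℤ.* (r ℤ.* r ℤ.- r ℤ.* s ℤ.+ s ℤ.* s)
  l = solve-∀

  l₂ : ∀ m t n k → m ℤ.* (m ℤ.+ t) ℤ.+ n ℤ.* (m ℤ.* k) ≡ m ℤ.* (m ℤ.+ (t ℤ.+ n ℤ.* k))
  l₂ = solve-∀

  l₃ : ∀ m t k → m ℤ.* k ℤ.+ t ℤ.* k ≡ k ℤ.* (m ℤ.+ t)
  l₃ = solve-∀

  -- Inserting N γ = mk into the expansion of N α = kp makes every summand a multiple of k, which is
  -- then cancelled.
  p≡ : p ≡ + m ℤ.+ (polar r s e f ℤ.+ N (e ∔ f ω) ℤ.* + k)
  p≡ = ℤₚ.*-cancelˡ-≡ (+ k) _ _ (begin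
    + k ℤ.* p
      ≡⟨ N≡kp ⟨
    N (a ∔ b ω)
      ≡⟨ cong₂ (λ a b → N (a ∔ b ω)) a≡r+ek b≡s+fk ⟩
    N (r ℤ.+ e ℤ.* + k ∔ s ℤ.+ f ℤ.* + k ω)
      ≡⟨ N-expand r s e f (+ k) ⟩
    N (r ∔ s ω) ℤ.+ (polar r s e f ℤ.+ N (e ∔ f ω) ℤ.* + k) ℤ.* + k
      ≡⟨ cong (ℤ._+ (polar r s e f ℤ.+ N (e ∔ f ω) ℤ.* + k) ℤ.* + k) N≡mk ⟩
    + m ℤ.* + k ℤ.+ (polar r s e f ℤ.+ N (e ∔ f ω) ℤ.* + k) ℤ.* + k
      ≡⟨ l₃ (+ m) (polar r s e f ℤ.+ N (e ∔ f ω) ℤ.* + k) (+ k) ⟩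
    + k ℤ.* (+ m ℤ.+ (polar r s e f ℤ.+ N (e ∔ f ω) ℤ.* + k)) ∎)

rationalPrime⇒nonZero : ∀ {p} → RationalPrime p → NonZero p
rationalPrime⇒nonZero p-prime = ℕ.prime⇒nonZero (rationalPrime⇒prime p-prime)

-- Cancelling m leaves p = m N(α/m). As 0 < m < p, the prime p does not divide m, so it divides
-- N(α/m); cancelling p shows that m divides 1.
N≡mp∧m∣α⇒m≡1 : ∀ {p m} a b → RationalPrime p → m ≢ 0 → m ℕ.< p →
                N (a ∔ b ω) ≡ + m ℤ.* + p → + m ∣ᶻ a → + m ∣ᶻ b → m ≡ 1
N≡mp∧m∣α⇒m≡1 {p} {m} _ _ p-prime m≢0 m<p N≡mp (divides e refl) (divides f refl) =
  [ (λ p∣m → contradiction (∣∧<⇒≡0 p∣m m<p) m≢0)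
  , (λ { (divides t N≡tp) → ℕ∣.∣1⇒≡1 (∣ᶻ.∣⇒∣ᵤ (divides t (1≡tm t N≡tp))) })
  ]′ (euclid p-prime (+ m) (N (e ∔ f ω)) (∣ᶻ.∣-reflexive p≡mN))
  where
  open ≡-Reasoning
  instance
    _ = rationalPrime⇒nonZero p-prime
    _ = ℕ.≢-nonZero m≢0

  l : ∀ e f m → (e ℤ.* m) ℤ.* (e ℤ.* m) ℤ.- (e ℤ.* m) ℤ.* (f ℤ.* m) ℤ.+ (f ℤ.* m) ℤ.* (f ℤ.* m)
              ≡ m ℤ.* (m ℤ.* (e ℤ.* e ℤ.- e ℤ.* f ℤ.+ f ℤ.* f))
  l = solve-∀

  l₂ : ∀ m t p → m ℤ.* (t ℤ.* p) ≡ (t ℤ.* m) ℤ.* p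
  l₂ = solve-∀

  p≡mN : + p ≡ + m ℤ.* N (e ∔ f ω)
  p≡mN = ℤₚ.*-cancelˡ-≡ (+ m) _ _ (trans (sym N≡mp) (l e f (+ m)))

  1≡tm : ∀ t → N (e ∔ f ω) ≡ t ℤ.* + p → + 1 ≡ t ℤ.* + m
  1≡tm t N≡tp = ℤₚ.*-cancelʳ-≡ (+ 1) (t ℤ.* + m) (+ p) (begin
    + 1 ℤ.* + p             ≡⟨ ℤₚ.*-identityˡ (+ p) ⟩
    + p                     ≡⟨ p≡mN ⟩
    + m ℤ.* N (e ∔ f ω)     ≡⟨ cong (ℤ._*_ (+ m)) N≡tp ⟩
    + m ℤ.* (t ℤ.* + p)     ≡⟨ l₂ (+ m) t (+ p) ⟩
    (t ℤ.* + m) ℤ.* + p     ∎)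

-- Well-founded induction on m. It stops when m divides α, which forces m = 1, so that α itself has
-- norm p.
descent : ∀ {p} → RationalPrime p → ∀ {m} → Acc ℕ._<_ m → m ≢ 0 → m ℕ.< p →
          ∀ a b → N (a ∔ b ω) ≡ + m ℤ.* + p → ∃[ β ] N β ≡ + p
descent {p} p-prime {m} (acc rec) m≢0 m<p a b N≡mp =
  case (reduce m {{ℕ.≢-nonZero m≢0}} a b
    (divides (+ p) (trans N≡mp (ℤₚ.*-comm (+ m) (+ p)))))
  where
  case : (+ m ∣ᶻ a × + m ∣ᶻ b) ⊎ Reduction m a b → ∃[ β ] N β ≡ + p
  case (inj₁ (m∣a , m∣b)) = (a ∔ b ω) , (begin
    N (a ∔ b ω)  ≡⟨ N≡mp ⟩
    + m ℤ.* + p  ≡⟨ cong (λ m → + m ℤ.* + p) (N≡mp∧m∣α⇒m≡1 a b p-prime m≢0 m<p N≡mp m∣a m∣b) ⟩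
    + 1 ℤ.* + p  ≡⟨ ℤₚ.*-identityˡ (+ p) ⟩
    + p          ∎)
    where open ≡-Reasoning
  case (inj₂ ρ) = next (descent-step m (+ p) a b {{ℕ.≢-nonZero m≢0}} N≡mp ρ)
    where
    open Reduction ρ using (m<k) renaming (m to m′; m≢0 to m′≢0)

    next : ∃[ β ] N β ≡ + m′ ℤ.* + p → ∃[ β ] N β ≡ + p
    next ((a′ ∔ b′ ω) , N≡m′p) =
      descent p-prime (rec m<k) m′≢0 (ℕₚ.<-trans m<k m<p) a′ b′ N≡m′p

-- N α / p may exceed p, so α is first reduced modulo p itself; the remainder has norm mp with m <
-- p, as the descent requires.
prime∣N⇒norm : ∀ {p} → RationalPrime p → ∀ a b → + p ∣ᶻ N (a ∔ b ω) →
               (+ p ∣ᶻ a × + p ∣ᶻ b) ⊎ ∃[ β ] N β ≡ + p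
prime∣N⇒norm {p} p-prime a b p∣N =
  Sum.map₂ base (reduce p {{rationalPrime⇒nonZero p-prime}} a b p∣N)
  where
  base : Reduction p a b → ∃[ β ] N β ≡ + p
  base ρ = descent p-prime (<-wellFounded m) m≢0 m<k r s N≡mk
    where open Reduction ρ

-- Prime elements of D over a rational prime

N-* : ∀ α β → N (α * β) ≡ N α ℤ.* N β
N-* (a ∔ b ω) (c ∔ d ω) = l a b c d
  where
  l : ∀ a b c d →
      (a ℤ.* c ℤ.- b ℤ.* d) ℤ.* (a ℤ.* c ℤ.- b ℤ.* d)
        ℤ.- (a ℤ.* c ℤ.- b ℤ.* d) ℤ.* (a ℤ.* d ℤ.+ b ℤ.* c ℤ.- b ℤ.* d)
        ℤ.+ (a ℤ.* d ℤ.+ b ℤ.* c ℤ.- b ℤ.* d) ℤ.* (a ℤ.* d ℤ.+ b ℤ.* c ℤ.- b ℤ.* d)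
    ≡ (a ℤ.* a ℤ.- a ℤ.* b ℤ.+ b ℤ.* b) ℤ.* (c ℤ.* c ℤ.- c ℤ.* d ℤ.+ d ℤ.* d)
  l = solve-∀

-- Minus the ω-coefficient of α conj(π). For π = x + yω of norm p it is y times
-- the image of α in D/π ≅ ℤ/p.
residueAt : D → D → ℤ
residueAt (x ∔ y ω) (a ∔ b ω) = y ℤ.* a ℤ.- x ℤ.* b

residueAt-multiple : ∀ π γ → residueAt π (γ * π) ≡ ℤ.- D.coeffω γ ℤ.* N π
residueAt-multiple (x ∔ y ω) (e ∔ f ω) = l x y e f
  where
  l : ∀ x y e f → y ℤ.* (e ℤ.* x ℤ.- f ℤ.* y) ℤ.- x ℤ.* (e ℤ.* y ℤ.+ f ℤ.* x ℤ.- f ℤ.* y)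
                ≡ ℤ.- f ℤ.* (x ℤ.* x ℤ.- x ℤ.* y ℤ.+ y ℤ.* y)
  l = solve-∀

-- Both values carry a factor y, the ω-coefficient of π. Modulo N π, their product is therefore y
-- times the value at αβ.
residueAt-* : ∀ π α β → residueAt π α ℤ.* residueAt π β
            ≡ D.coeffω π ℤ.* residueAt π (α * β) ℤ.+ (D.coeffω α ℤ.* D.coeffω β) ℤ.* N π
residueAt-* (x ∔ y ω) (a ∔ b ω) (c ∔ d ω) = l x y a b c d
  where
  l : ∀ x y a b c d →
      (y ℤ.* a ℤ.- x ℤ.* b) ℤ.* (y ℤ.* c ℤ.- x ℤ.* d)
    ≡ y ℤ.* (y ℤ.* (a ℤ.* c ℤ.- b ℤ.* d) ℤ.- x ℤ.* (a ℤ.* d ℤ.+ b ℤ.* c ℤ.- b ℤ.* d))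
        ℤ.+ (b ℤ.* d) ℤ.* (x ℤ.* x ℤ.- x ℤ.* y ℤ.+ y ℤ.* y)
  l = solve-∀

module _ {p} (p-prime : RationalPrime p) where

  private instance
    _ = rationalPrime⇒nonZero p-prime

  -- α conj(π) = A - hpω has norm p N α, so p ∣ A² and A = gp. Since p = π conj(π), cancelling
  -- conj(π) leaves α = (g - hω)π; the code checks this by coefficients, multiplied by p.
  p∣residueAt⇒π∣ : ∀ π α → N π ≡ + p → + p ∣ᶻ residueAt π α → π ∣ α
  p∣residueAt⇒π∣ (x ∔ y ω) (a ∔ b ω) Nπ≡p (divides h res≡hp) =
    divide (Sum.reduce (euclid p-prime A A p∣A²))
    where
    A : ℤ
    A = x ℤ.* a ℤ.- y ℤ.* a ℤ.+ y ℤ.* b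

    l-A² : ∀ x y a b →
        (x ℤ.* a ℤ.- y ℤ.* a ℤ.+ y ℤ.* b) ℤ.* (x ℤ.* a ℤ.- y ℤ.* a ℤ.+ y ℤ.* b)
      ≡ (a ℤ.* a ℤ.- a ℤ.* b ℤ.+ b ℤ.* b) ℤ.* (x ℤ.* x ℤ.- x ℤ.* y ℤ.+ y ℤ.* y)
        ℤ.+ (x ℤ.* b ℤ.- x ℤ.* a ℤ.- y ℤ.* b) ℤ.* (y ℤ.* a ℤ.- x ℤ.* b)
    l-A² = solve-∀

    p∣A² : + p ∣ᶻ A ℤ.* A
    p∣A² = subst (+ p ∣ᶻ_) (sym (l-A² x y a b))
      (∣-lincomb (N (a ∔ b ω)) (x ℤ.* b ℤ.- x ℤ.* a ℤ.- y ℤ.* b)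
        (∣ᶻ.∣-reflexive (sym Nπ≡p)) (divides h res≡hp))

    divide : + p ∣ᶻ A → (x ∔ y ω) ∣ (a ∔ b ω)
    divide (divides g A≡gp) = (g ∔ ℤ.- h ω) , cong₂ _∔_ω
      (cancel (trans (l₁ g h x y (+ p)) (trans (cong₂ (λ A B → x ℤ.* A ℤ.+ y ℤ.* B)
        (sym A≡gp) (sym res≡hp)) (trans (l₂ x y a b) (cong (a ℤ.*_) Nπ≡p)))))
      (cancel (trans (l₃ g h x y (+ p)) (trans (cong₂ (λ A B → y ℤ.* A ℤ.+ (y ℤ.- x) ℤ.* B)
        (sym A≡gp) (sym res≡hp)) (trans (l₄ x y a b) (cong (b ℤ.*_) Nπ≡p)))))
      where
      cancel : ∀ {u v} → u ℤ.* + p ≡ v ℤ.* + p → u ≡ v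
      cancel {u} {v} = ℤₚ.*-cancelʳ-≡ u v (+ p)

      l₁ : ∀ g h x y p → (g ℤ.* x ℤ.- ℤ.- h ℤ.* y) ℤ.* p
                       ≡ x ℤ.* (g ℤ.* p) ℤ.+ y ℤ.* (h ℤ.* p)
      l₁ = solve-∀
      l₂ : ∀ x y a b → x ℤ.* (x ℤ.* a ℤ.- y ℤ.* a ℤ.+ y ℤ.* b) ℤ.+ y ℤ.* (y ℤ.* a ℤ.- x ℤ.* b)
                     ≡ a ℤ.* (x ℤ.* x ℤ.- x ℤ.* y ℤ.+ y ℤ.* y)
      l₂ = solve-∀
      l₃ : ∀ g h x y p → (g ℤ.* y ℤ.+ ℤ.- h ℤ.* x ℤ.- ℤ.- h ℤ.* y) ℤ.* p
                       ≡ y ℤ.* (g ℤ.* p) ℤ.+ (y ℤ.- x) ℤ.* (h ℤ.* p)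
      l₃ = solve-∀
      l₄ : ∀ x y a b →
          y ℤ.* (x ℤ.* a ℤ.- y ℤ.* a ℤ.+ y ℤ.* b) ℤ.+ (y ℤ.- x) ℤ.* (y ℤ.* a ℤ.- x ℤ.* b)
        ≡ b ℤ.* (x ℤ.* x ℤ.- x ℤ.* y ℤ.+ y ℤ.* y)
      l₄ = solve-∀

  -- `residueAt π` modulo p detects divisibility by π, so Euclid's lemma for p transfers to π. That
  -- π is not a unit follows by taking norms.
  norm⇒prime : ∀ π → N π ≡ + p → Prime π
  norm⇒prime π Nπ≡p = record
    { p≉0     = λ π≡0 → ℤ-Ring.Prime.p≉0 p-prime (trans (sym Nπ≡p) (cong N π≡0))
    ; p∤1     = λ (γ , γπ≡1) → rationalPrime-∤1 p-prime (divides (N γ) (begin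
        + 1            ≡⟨ cong N γπ≡1 ⟨
        N (γ * π)      ≡⟨ N-* γ π ⟩
        N γ ℤ.* N π    ≡⟨ cong (ℤ._*_ (N γ)) Nπ≡p ⟩
        N γ ℤ.* + p    ∎))
    ; split-∣ = λ {α} {β} (γ , γπ≡αβ) →
        Sum.map (p∣residueAt⇒π∣ π α Nπ≡p) (p∣residueAt⇒π∣ π β Nπ≡p)
          (euclid p-prime (residueAt π α) (residueAt π β) (p∣residues α β γ γπ≡αβ))
    }
    where
    open ≡-Reasoning

    p∣Nπ : + p ∣ᶻ N π
    p∣Nπ = ∣ᶻ.∣-reflexive (sym Nπ≡p)

    p∣residues : ∀ α β γ → γ * π ≡ α * β → + p ∣ᶻ residueAt π α ℤ.* residueAt π β
    p∣residues α β γ γπ≡αβ = subst (+ p ∣ᶻ_) (sym (residueAt-* π α β))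
      (∣-lincomb (D.coeffω π) (D.coeffω α ℤ.* D.coeffω β)
        (subst (λ δ → + p ∣ᶻ residueAt π δ) γπ≡αβ
          (subst (+ p ∣ᶻ_) (sym (residueAt-multiple π γ)) (∣n⇒∣m*n (ℤ.- D.coeffω γ) p∣Nπ)))
        p∣Nπ)

  ι-∣ : ∀ {a b} → + p ∣ᶻ a → + p ∣ᶻ b → ι (+ p) ∣ (a ∔ b ω)
  ι-∣ (divides e refl) (divides f refl) = (e ∔ f ω) , cong₂ _∔_ω (l₁ e f (+ p)) (l₂ e f (+ p))
    where
    l₁ : ∀ e f p → e ℤ.* p ℤ.- f ℤ.* + 0 ≡ e ℤ.* p
    l₁ = solve-∀
    l₂ : ∀ e f p → e ℤ.* + 0 ℤ.+ f ℤ.* p ℤ.- f ℤ.* + 0 ≡ f ℤ.* p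
    l₂ = solve-∀

  N-ι : N (ι (+ p)) ≡ + p ℤ.* + p
  N-ι = l (+ p)
    where
    l : ∀ p → p ℤ.* p ℤ.- p ℤ.* + 0 ℤ.+ + 0 ℤ.* + 0 ≡ p ℤ.* p
    l = solve-∀

  p∣N[ι*] : ∀ γ → + p ∣ᶻ N (γ * ι (+ p))
  p∣N[ι*] γ = subst (+ p ∣ᶻ_) (sym (trans (N-* γ (ι (+ p))) (cong (ℤ._*_ (N γ)) N-ι)))
    (∣n⇒∣m*n (N γ) (∣n⇒∣m*n (+ p) ∣ᶻ.∣-refl))

  -- If p ∣ αβ, then p ∣ N α N β, hence p divides one of the two norms. `prime∣N⇒norm` then makes p
  -- divide α or β, its other outcome being excluded.
  not-norm⇒prime : (∀ β → N β ≢ + p) → Prime (ι (+ p))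
  not-norm⇒prime not-norm = record
    { p≉0     = λ ι≡0 → ℤ-Ring.Prime.p≉0 p-prime (cong D.coeff₁ ι≡0)
    ; p∤1     = λ (γ , γp≡1) → rationalPrime-∤1 p-prime
        (subst (λ δ → + p ∣ᶻ N δ) γp≡1 (p∣N[ι*] γ))
    ; split-∣ = λ {α} {β} (γ , γp≡αβ) → Sum.map (ι∣ α) (ι∣ β)
        (euclid p-prime (N α) (N β)
          (subst (+ p ∣ᶻ_) (N-* α β) (subst (λ δ → + p ∣ᶻ N δ) γp≡αβ (p∣N[ι*] γ))))
    }
    where
    ι∣ : ∀ α → + p ∣ᶻ N α → ι (+ p) ∣ α
    ι∣ (a ∔ b ω) p∣N =
      [ (λ (p∣a , p∣b) → ι-∣ p∣a p∣b)
      , (λ (β , Nβ≡p) → contradiction Nβ≡p (not-norm β))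
      ]′ (prime∣N⇒norm p-prime a b p∣N)

-- Norms modulo 3 and the three assertions

-- N(x + yω) = (x + y)² - 3xy is a square modulo 3.
N≢2[mod3] : ∀ {q} → q % 3 ≡ 2 → ∀ β → N β ≢ + q
N≢2[mod3] {q} q%3≡2 (x ∔ y ω) N≡q =
  non-square ((x ℤ.+ y) ℤ.%ℕ 3) (ℤ.n%ℕd<d (x ℤ.+ y) 3)
    ((x ℤ.+ y) ℤ./ℕ 3) (ℤ.a≡a%ℕn+[a/ℕn]*n (x ℤ.+ y) 3)
  where
  open ≡-Reasoning

  w : ℤ
  w = + (q ℕ./ 3)

  q≡ : + q ≡ + 2 ℤ.+ w ℤ.* + 3
  q≡ = begin
    + q                            ≡⟨ cong +_ (m≡m%n+[m/n]*n q 3) ⟩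
    + (q % 3 ℕ.+ q ℕ./ 3 ℕ.* 3)    ≡⟨ cong (λ r → + (r ℕ.+ q ℕ./ 3 ℕ.* 3)) q%3≡2 ⟩
    + 2 ℤ.+ + (q ℕ./ 3 ℕ.* 3)      ≡⟨ cong (ℤ._+_ (+ 2)) (ℤₚ.pos-* (q ℕ./ 3) 3) ⟩
    + 2 ℤ.+ w ℤ.* + 3              ∎

  l₁ : ∀ x y → x ℤ.* x ℤ.- x ℤ.* y ℤ.+ y ℤ.* y
             ≡ (x ℤ.+ y) ℤ.* (x ℤ.+ y) ℤ.- x ℤ.* y ℤ.* + 3
  l₁ = solve-∀

  l₂ : ∀ w r → + 2 ℤ.- r ℤ.* r ≡ (+ 2 ℤ.+ w ℤ.* + 3) ℤ.- r ℤ.* r ℤ.- w ℤ.* + 3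
  l₂ = solve-∀

  l₃ : ∀ r t z w → (r ℤ.+ t ℤ.* + 3) ℤ.* (r ℤ.+ t ℤ.* + 3) ℤ.- z ℤ.* + 3 ℤ.- r ℤ.* r ℤ.- w ℤ.* + 3
                 ≡ (+ 2 ℤ.* (r ℤ.* t) ℤ.+ + 3 ℤ.* (t ℤ.* t) ℤ.- z ℤ.- w) ℤ.* + 3
  l₃ = solve-∀

  3∣2-r² : ∀ r t → x ℤ.+ y ≡ r ℤ.+ t ℤ.* + 3 → + 3 ∣ᶻ + 2 ℤ.- r ℤ.* r
  3∣2-r² r t x+y≡ = divides (+ 2 ℤ.* (r ℤ.* t) ℤ.+ + 3 ℤ.* (t ℤ.* t) ℤ.- x ℤ.* y ℤ.- w) (begin
    + 2 ℤ.- r ℤ.* r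
      ≡⟨ l₂ w r ⟩
    (+ 2 ℤ.+ w ℤ.* + 3) ℤ.- r ℤ.* r ℤ.- w ℤ.* + 3
      ≡⟨ cong (λ n → n ℤ.- r ℤ.* r ℤ.- w ℤ.* + 3) (trans (sym q≡) (trans (sym N≡q) (l₁ x y))) ⟩
    (x ℤ.+ y) ℤ.* (x ℤ.+ y) ℤ.- x ℤ.* y ℤ.* + 3 ℤ.- r ℤ.* r ℤ.- w ℤ.* + 3
      ≡⟨ cong (λ s → s ℤ.* s ℤ.- x ℤ.* y ℤ.* + 3 ℤ.- r ℤ.* r ℤ.- w ℤ.* + 3) x+y≡ ⟩
    (r ℤ.+ t ℤ.* + 3) ℤ.* (r ℤ.+ t ℤ.* + 3) ℤ.- x ℤ.* y ℤ.* + 3 ℤ.- r ℤ.* r ℤ.- w ℤ.* + 3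
      ≡⟨ l₃ r t (x ℤ.* y) w ⟩
    (+ 2 ℤ.* (r ℤ.* t) ℤ.+ + 3 ℤ.* (t ℤ.* t) ℤ.- x ℤ.* y ℤ.- w) ℤ.* + 3 ∎)

  non-square : ∀ r → r ℕ.< 3 → ∀ t → ¬ x ℤ.+ y ≡ + r ℤ.+ t ℤ.* + 3
  -- For r = 0, 1, 2 the number 2 - r² is 2, 1, -2, never a multiple of 3.
  non-square 0 _ t x+y≡ = from-no (+ 3 ∣ᶻ.∣? + 2) (3∣2-r² (+ 0) t x+y≡)
  non-square 1 _ t x+y≡ = from-no (+ 3 ∣ᶻ.∣? + 1) (3∣2-r² (+ 1) t x+y≡)
  non-square 2 _ t x+y≡ = from-no (+ 3 ∣ᶻ.∣? -[1+ 1 ]) (3∣2-r² (+ 2) t x+y≡)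
  non-square (suc (suc (suc _))) (s≤s (s≤s (s≤s ())))

p≡1[mod3]⇒norm : ∀ {p} → RationalPrime p → p % 3 ≡ 1 → ∃[ π ] N π ≡ + p
p≡1[mod3]⇒norm {zero}        _       ()
p≡1[mod3]⇒norm {suc zero}    p-prime _ = contradiction ∣ᶻ.∣-refl (rationalPrime-∤1 p-prime)
p≡1[mod3]⇒norm {suc (suc _)} p-prime p%3≡1 =
  from-root (p≡1[mod3]⇒∣N[a+ω] (rationalPrime⇒prime p-prime) p%3≡1)
  where
  from-root : ∃[ a ] (_ ∣ᶻ N (a ∔ + 1 ω)) → ∃[ π ] N π ≡ _
  from-root (a , p∣N) =
    -- The ω-coefficient of a + ω is 1, so p cannot divide both coefficients.
    [ (λ (_ , p∣1) → contradiction p∣1 (rationalPrime-∤1 p-prime))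
    , (λ β → β)
    ]′ (prime∣N⇒norm p-prime a (+ 1) p∣N)

-- Serves 1 - ω, whose norm is 3. Euclid's lemma in ℕ is applied to absolute values.
rationalPrime[3] : RationalPrime 3
rationalPrime[3] = record
  { p≉0     = λ ()
  ; p∤1     = λ (q , q*3≡1) → from-no (+ 3 ∣ᶻ.∣? + 1) (divides q (sym q*3≡1))
  ; split-∣ = λ {x} {y} (q , q*3≡xy) → Sum.map signed signed
      (ℕ.euclidsLemma ℤ.∣ x ∣ ℤ.∣ y ∣ (from-yes (ℕ.prime? 3))
        (subst (3 ℕ∣.∣_) (ℤₚ.abs-* x y) (∣ᶻ.∣⇒∣ᵤ (divides q (sym q*3≡xy)))))
  }
  where
  signed : ∀ {x} → 3 ℕ∣.∣ ℤ.∣ x ∣ → + 3 ℤ-Ring.∣ x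
  signed {x} 3∣x with ∣ᶻ.∣ᵤ⇒∣ {+ 3} {x} 3∣x
  ... | divides q x≡q*3 = q , sym x≡q*3

theorem3p4 : (∀ (q : ℕ) → RationalPrime q → q % 3 ≡ 2 → Prime (ι (+ q)))
    × (∀ (p : ℕ) → RationalPrime p → p % 3 ≡ 1 →
    ∃[ π ] (Prime π × + p ≡ N π × ι (+ p) ≡ π * conj π))
    × (ι (+ 3) ≡ (- (ω ^ 2)) * ((1# - ω) ^ 2) × Prime (1# - ω))
theorem3p4 =
    (λ q q-prime q%3≡2 → not-norm⇒prime q-prime (N≢2[mod3] q%3≡2))
  , (λ p p-prime p%3≡1 → map₂ (λ {π} Nπ≡p →
        norm⇒prime p-prime π Nπ≡p
      , sym Nπ≡p
      , trans (cong ι (sym Nπ≡p)) (N≡*conj π))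
      (p≡1[mod3]⇒norm p-prime p%3≡1))
  -- The identity holds by evaluation: (1 - ω)² = -3ω and ω³ = 1. So does N(1 - ω) = 3.
  , (refl , norm⇒prime rationalPrime[3] (1# - ω) refl)
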